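{- Let $m\ge 2$ and let $\mathcal{F}$ be a family of subsets of $[n]$. Assume that there are no $m+2$ different sets $A,B_1,B_2,\dots,B_m,C\in\mathcal{F}$ such that $A\subset B_i\subset C$ for all $1\le i\le m$ and $|B_1|=|B_2|=\dots=|B_m|$. Then $$|\mathcal{F}|\le 3\left(\lceil\log_3(m-1)\rceil+1\right)\binom{n}{\lfloor\frac{n}{2}\rfloor}.$$
   Context: $[n]=\{1,2,\dots,n\}$. -}

module Defs where

open import Data.Nat using (ℕ; zero; suc; _^_; _≤?_)
open import Relation.Nullary using (yes; no)

ceilLog3-from : ℕ → ℕ → ℕ → ℕ
ceilLog3-from k e zero = e
ceilLog3-from k e (suc fuel) with k ≤? 3 ^ e
... | yes _ = e
... | no _  = ceilLog3-from k (suc e) fuel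

-- ⌈log₃ k⌉ for k ≥ 1 : the least e with k ≤ 3 ^ e  (found within k steps since k ≤ 3 ^ k)
ceilLog3 : ℕ → ℕ
ceilLog3 k = ceilLog3-from k 0 k

{-# OPTIONS --safe #-}
module Submission where

-- Sort the maximal chains of the cube by the first member A and the last member Z of F on them.
-- Within such a class the part between A and Z is an arbitrary maximal chain of [A, Z], so it
-- suffices to bound the average number of members of F on those by 3 (e + 1), where
-- e = ⌈log₃ (m - 1)⌉; the LYM argument then gives the factor 3 (e + 1). Let N = |Z| - |A|.
-- Every level of [A, Z] contributes at most 1, which is enough if N + 1 ≤ 3 (e + 1). Otherwise the
-- e + 1 lowest and e + 1 highest levels contribute at most 2 (e + 1), and each other level holds at
-- most 3 ^ e members of F, hence contributes at most 3 ^ e / (N choose e + 1). This is at most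
-- (e + 1) / N, because (e + 1) (N choose e + 1) = N (N - 1 choose e) ≥ N 3 ^ e for N > 3 e.
-- All averages are multiplied by factorials, so that only natural numbers occur.

open import Defs
open import Data.Nat using (ℕ; _≤_; _*_; _+_; _∸_; _/_)
open import Data.Nat.Combinatorics using (_C_)
open import Data.Fin using (Fin)
open import Data.Fin.Subset using (Subset; _⊂_; ∣_∣)
open import Data.List using (List; length)
open import Data.List.Membership.Propositional using (_∈_)
open import Data.List.Relation.Unary.Unique.Propositional using (Unique)
open import Data.Product using (_×_)
open import Relation.Binary.PropositionalEquality using (_≡_; _≢_)
open import Relation.Nullary using (¬_)
open import Function.Definitions using (Injective)

open import Data.Nat using (zero; suc; pred; z≤n; s≤s; s≤s⁻¹; _<_; _^_; _!; _≟_; _≤?_)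
open import Data.Nat.Combinatorics using (nCk≡n!/k![n-k]!; k![n∸k]!∣n!)
open import Data.Nat.DivMod using (m/n*n≡m; m/n*n≤m; m≡m%n+[m/n]*n; m%n<n; m/n≤m; _%_)
open import Data.Nat.ListAction using (sum)
open import Data.Nat.ListAction.Properties using (sum-++)
open import Data.Nat.Properties hiding (_≟_; _≤?_)
open import Data.Nat.Tactic.RingSolver using (solve-∀)
open import Data.Bool using (if_then_else_)
import Data.Bool.Properties as Bool
open import Data.Fin using (zero; suc; inject≤)
open import Data.Fin.Properties using (inject≤-injective)
open import Data.Fin.Subset using (inside; outside; _⊆_; ∁; ⊥)
open import Data.Fin.Subset.Properties using (_⊆?_; _⊂?_; _∈?_; ⊆-refl; ⊆-reflexive; ⊆-trans; ⊆-antisym; p⊆q⇒∣p∣≤∣q∣; ∣p∣≤n; ∣∁p∣≡n∸∣p∣; p⊆q⇒∁p⊇∁q; ∁p⊆∁q⇒p⊇q; drop-∷-⊆; ⊥⊆; ∣⊥∣≡0)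
open import Data.List using ([]; _∷_; _++_; map; filter; lookup; applyUpTo)
open import Data.List.Membership.Propositional.Properties using (∈-map⁻; ∈-map⁺; ∈-lookup; ∈-filter⁻; ∈-applyUpTo⁺; ∈-applyUpTo⁻)
open import Data.List.Properties using (map-∘; map-++; length-applyUpTo; length-map)
open import Data.List.Relation.Unary.All as All using ()
open import Data.List.Relation.Unary.AllPairs using ([]; _∷_)
open import Data.List.Relation.Unary.Any using (here; there)
open import Data.List.Relation.Unary.Unique.Propositional.Properties using (filter⁺; map⁺)
open import Data.Product using (_,_; proj₁; proj₂)
open import Data.Vec as Vec using ([]; _∷_)
open import Data.Vec.Properties using (≡-dec)
open import Function using (_∘_; case_of_)
open import Relation.Binary.PropositionalEquality using (refl; sym; trans; cong; cong₂; subst)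
open import Relation.Nullary using (Dec; yes; no; does; contradiction; _×-dec_)
open import Relation.Nullary.Decidable using (dec-true; dec-false)
open import Relation.Unary using (Decidable)

private variable
  n : ℕ
  I J P Q : Set

-- Indicators of decidable propositions and sums over lists.

𝟙 : Dec P → ℕ
𝟙 d = if does d then 1 else 0

𝟙-yes : (d : Dec P) → P → 𝟙 d ≡ 1
𝟙-yes d p rewrite dec-true d p = refl

𝟙-no : (d : Dec P) → ¬ P → 𝟙 d ≡ 0
𝟙-no d ¬p rewrite dec-false d ¬p = refl

𝟙≢0⇒ : (d : Dec P) → 𝟙 d ≢ 0 → P
𝟙≢0⇒ (yes p) _  = p
𝟙≢0⇒ (no _)  ≢0 = contradiction refl ≢0

𝟙*≤ : (d : Dec P) (x : ℕ) → 𝟙 d * x ≤ x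
𝟙*≤ (yes _) x = ≤-reflexive (+-identityʳ x)
𝟙*≤ (no _)  x = z≤n

𝟙*≡0 : (d : Dec P) {x : ℕ} → (P → x ≡ 0) → 𝟙 d * x ≡ 0
𝟙*≡0 (yes p) eq = trans (+-identityʳ _) (eq p)
𝟙*≡0 (no _)  eq = refl

𝟙-cong : (d : Dec P) (d′ : Dec Q) → (P → Q) → (Q → P) → 𝟙 d ≡ 𝟙 d′
𝟙-cong (yes p) d′ f g = sym (𝟙-yes d′ (f p))
𝟙-cong (no ¬p) d′ f g = sym (𝟙-no d′ (¬p ∘ g))

∑ : List I → (I → ℕ) → ℕ
∑ xs f = sum (map f xs)

∑-cong : (xs : List I) {f g : I → ℕ} → (∀ {x} → x ∈ xs → f x ≡ g x) → ∑ xs f ≡ ∑ xs g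
∑-cong []       eq = refl
∑-cong (x ∷ xs) eq = cong₂ _+_ (eq (here refl)) (∑-cong xs (eq ∘ there))

∑-mono : (xs : List I) {f g : I → ℕ} → (∀ {x} → x ∈ xs → f x ≤ g x) → ∑ xs f ≤ ∑ xs g
∑-mono []       le = z≤n
∑-mono (x ∷ xs) le = +-mono-≤ (le (here refl)) (∑-mono xs (le ∘ there))

∑-+ : (xs : List I) (f g : I → ℕ) → ∑ xs (λ x → f x + g x) ≡ ∑ xs f + ∑ xs g
∑-+ []       f g = refl
∑-+ (x ∷ xs) f g = trans (cong (f x + g x +_) (∑-+ xs f g)) (swap (f x) (g x) (∑ xs f) (∑ xs g))
  where
  swap : ∀ a b c d → a + b + (c + d) ≡ a + c + (b + d)
  swap = solve-∀

∑-*ˡ : (xs : List I) (c : ℕ) (f : I → ℕ) → ∑ xs (λ x → c * f x) ≡ c * ∑ xs f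
∑-*ˡ []       c f = sym (*-zeroʳ c)
∑-*ˡ (x ∷ xs) c f = trans (cong (c * f x +_) (∑-*ˡ xs c f)) (sym (*-distribˡ-+ c (f x) _))

∑-*ʳ : (xs : List I) (f : I → ℕ) (c : ℕ) → ∑ xs (λ x → f x * c) ≡ ∑ xs f * c
∑-*ʳ []       f c = refl
∑-*ʳ (x ∷ xs) f c = trans (cong (f x * c +_) (∑-*ʳ xs f c)) (sym (*-distribʳ-+ c (f x) _))

∑-const : (xs : List I) (c : ℕ) → ∑ xs (λ _ → c) ≡ length xs * c
∑-const []       c = refl
∑-const (x ∷ xs) c = cong (c +_) (∑-const xs c)

∑-≤-const : (xs : List I) {f : I → ℕ} (c : ℕ) → (∀ {x} → x ∈ xs → f x ≤ c) → ∑ xs f ≤ length xs * c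
∑-≤-const xs c le = ≤-trans (∑-mono xs le) (≤-reflexive (∑-const xs c))

∑-zero : (xs : List I) {f : I → ℕ} → (∀ {x} → x ∈ xs → f x ≡ 0) → ∑ xs f ≡ 0
∑-zero xs eq = trans (∑-cong xs eq) (trans (∑-const xs 0) (*-zeroʳ (length xs)))

∑-swap : (xs : List I) (ys : List J) (f : I → J → ℕ) →
  ∑ xs (λ x → ∑ ys (f x)) ≡ ∑ ys (λ y → ∑ xs (λ x → f x y))
∑-swap []       ys f = sym (∑-zero ys (λ _ → refl))
∑-swap (x ∷ xs) ys f = trans (cong (∑ ys (f x) +_) (∑-swap xs ys f)) (sym (∑-+ ys (f x) _))

∑-map : (xs : List I) (g : I → J) (f : J → ℕ) → ∑ (map g xs) f ≡ ∑ xs (f ∘ g)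
∑-map xs g f = cong sum (sym (map-∘ xs))

∑-++ : (xs ys : List I) (f : I → ℕ) → ∑ (xs ++ ys) f ≡ ∑ xs f + ∑ ys f
∑-++ xs ys f = trans (cong sum (map-++ f xs ys)) (sum-++ (map f xs) (map f ys))

term≤∑ : (f : I → ℕ) {x : I} {xs : List I} → x ∈ xs → f x ≤ ∑ xs f
term≤∑ f (here refl)           = m≤m+n _ _
term≤∑ f (there {x = y} x∈xs) = ≤-trans (term≤∑ f x∈xs) (m≤n+m _ (f y))

∑≤length-filter : {P : I → Set} (P? : Decidable P) (xs : List I) {f : I → ℕ} (c : ℕ) →
  (∀ {x} → x ∈ xs → P x → f x ≤ c) → (∀ {x} → x ∈ xs → ¬ P x → f x ≡ 0) →
  ∑ xs f ≤ length (filter P? xs) * c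
∑≤length-filter P? []       c le eq = z≤n
∑≤length-filter P? (x ∷ xs) c le eq with P? x | ∑≤length-filter P? xs c (le ∘ there) (eq ∘ there)
... | yes p | rec = +-mono-≤ (le (here refl) p) rec
... | no ¬p | rec rewrite eq (here refl) ¬p = rec

applyUpTo-+ : (f : ℕ → I) (m k : ℕ) → applyUpTo f (m + k) ≡ applyUpTo f m ++ applyUpTo (λ i → f (m + i)) k
applyUpTo-+ f zero    k = refl
applyUpTo-+ f (suc m) k = cong (f 0 ∷_) (applyUpTo-+ (f ∘ suc) m k)

lookup-injective : {xs : List I} → Unique xs → Injective _≡_ _≡_ (lookup xs)
lookup-injective (x∉ ∷ u) {zero}  {zero}  eq = refl
lookup-injective (x∉ ∷ u) {zero}  {suc j} eq = contradiction eq (All.lookup x∉ (∈-lookup j))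
lookup-injective (x∉ ∷ u) {suc i} {zero}  eq = contradiction (sym eq) (All.lookup x∉ (∈-lookup i))
lookup-injective (x∉ ∷ u) {suc i} {suc j} eq = cong suc (lookup-injective u eq)

-- Powers of three and inequalities between factorials.

n<3^n : ∀ k → k < 3 ^ k
n<3^n zero    = s≤s z≤n
n<3^n (suc k) = ≤-trans (s≤s (n<3^n k)) (+-mono-≤ (≤-trans (s≤s z≤n) (n<3^n k)) (m≤m+n (3 ^ k) _))

-- The search ends by success or by exhausted fuel. The invariant `k ≤ 3 ^ (e + fuel)` settles the
-- second case; it holds at the start because `k ≤ 3 ^ k`.
≤3^ceilLog3-from : ∀ k e fuel → k ≤ 3 ^ (e + fuel) → k ≤ 3 ^ ceilLog3-from k e fuel
≤3^ceilLog3-from k e zero       le = subst (λ i → k ≤ 3 ^ i) (+-identityʳ e) le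
≤3^ceilLog3-from k e (suc fuel) le with k ≤? 3 ^ e
... | yes k≤ = k≤
... | no _   = ≤3^ceilLog3-from k (suc e) fuel (subst (λ i → k ≤ 3 ^ i) (+-suc e fuel) le)

≤3^ceilLog3 : ∀ k → k ≤ 3 ^ ceilLog3 k
≤3^ceilLog3 k = ≤3^ceilLog3-from k 0 k (<⇒≤ (n<3^n k))

-- The factors `a + 1`, ..., `a + p` of `(a + p) !` beyond `a !` are at most the factors
-- `a + q + 1`, ..., `a + q + p` on the right. This serves both the middle levels of an interval and
-- the central binomial coefficient.
!-logConvex : ∀ a p q → (a + p) ! * (a + q) ! ≤ a ! * (a + p + q) !
!-logConvex a zero    q rewrite +-identityʳ a = ≤-refl
!-logConvex a (suc p) q rewrite +-suc a p = begin
  suc (a + p) * (a + p) ! * (a + q) !        ≡⟨ *-assoc (suc (a + p)) ((a + p) !) _ ⟩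
  suc (a + p) * ((a + p) ! * (a + q) !)      ≤⟨ *-mono-≤ (s≤s (m≤m+n (a + p) q)) (!-logConvex a p q) ⟩
  suc (a + p + q) * (a ! * (a + p + q) !)    ≡⟨ swap (suc (a + p + q)) (a !) _ ⟩
  a ! * (suc (a + p + q) * (a + p + q) !)    ∎
  where
  open ≤-Reasoning
  swap : ∀ x y z → x * (y * z) ≡ y * (x * z)
  swap = solve-∀

-- This is `3 ^ e ≤ (e + M) C e` without division. Raising `e` by one multiplies the binomial
-- coefficient by `(suc e + M) / suc e`, which is at least 3 as long as `M` is at least `2 * suc e`.
3^e*e!*M!≤[e+M]! : ∀ e M → e + e ≤ M → 3 ^ e * (e ! * M !) ≤ (e + M) !
3^e*e!*M!≤[e+M]! zero    M le = ≤-reflexive (trans (*-identityˡ (1 * M !)) (*-identityˡ (M !)))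
3^e*e!*M!≤[e+M]! (suc e) M le = begin
  3 * 3 ^ e * (suc e * e ! * M !)        ≡⟨ swap (3 ^ e) (suc e) (e !) (M !) ⟩
  3 * suc e * (3 ^ e * (e ! * M !))      ≤⟨ *-mono-≤ 3e≤ (3^e*e!*M!≤[e+M]! e M (≤-trans (+-mono-≤ (n≤1+n e) (n≤1+n e)) le)) ⟩
  (suc e + M) * (e + M) !                ∎
  where
  open ≤-Reasoning
  swap : ∀ a b c d → 3 * a * (b * c * d) ≡ 3 * b * (a * (c * d))
  swap = solve-∀
  triple : ∀ x → 3 * x ≡ x + (x + x)
  triple = solve-∀
  3e≤ : 3 * suc e ≤ suc e + M
  3e≤ = ≤-trans (≤-reflexive (triple (suc e))) (+-monoʳ-≤ (suc e) le)

-- Inclusion, equality and size of subsets.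

𝟙⊆ : Subset n → Subset n → ℕ
𝟙⊆ A X = 𝟙 (A ⊆? X)

_≟ˢ_ : (A X : Subset n) → Dec (A ≡ X)
_≟ˢ_ = ≡-dec Bool._≟_

𝟙≡ : Subset n → Subset n → ℕ
𝟙≡ A X = 𝟙 (A ≟ˢ X)

𝟙≡-subst : (A X : Subset n) (f : Subset n → ℕ) → 𝟙≡ A X * f A ≡ 𝟙≡ A X * f X
𝟙≡-subst A X f with A ≟ˢ X
... | yes refl = refl
... | no _     = refl

∑-𝟙≡ : (F : List (Subset n)) (X : Subset n) (f : Subset n → ℕ) →
  ∑ F (λ A → 𝟙≡ A X * f A) ≡ ∑ F (λ A → 𝟙≡ A X) * f X
∑-𝟙≡ F X f = trans (∑-cong F (λ {A} _ → 𝟙≡-subst A X f)) (∑-*ʳ F (λ A → 𝟙≡ A X) (f X))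

∑-𝟙≡≤1 : {F : List (Subset n)} → Unique F → (X : Subset n) → ∑ F (λ A → 𝟙≡ A X) ≤ 1
∑-𝟙≡≤1 []                    X = z≤n
∑-𝟙≡≤1 {F = A ∷ F} (A∉ ∷ u) X with A ≟ˢ X
... | yes refl = s≤s (≤-reflexive (∑-zero F λ {Y} Y∈F → 𝟙-no (Y ≟ˢ A) λ { refl → All.lookup A∉ Y∈F refl }))
... | no _     = ∑-𝟙≡≤1 u X

∣X∣≤∣A∣⇒A⊆X⇒A≡X : (A X : Subset n) → ∣ X ∣ ≤ ∣ A ∣ → A ⊆ X → A ≡ X
∣X∣≤∣A∣⇒A⊆X⇒A≡X []            []            le A⊆X = refl
∣X∣≤∣A∣⇒A⊆X⇒A≡X (outside ∷ A) (outside ∷ X) le A⊆X = cong (outside ∷_) (∣X∣≤∣A∣⇒A⊆X⇒A≡X A X le (drop-∷-⊆ A⊆X))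
∣X∣≤∣A∣⇒A⊆X⇒A≡X (outside ∷ A) (inside ∷ X)  le A⊆X = contradiction (p⊆q⇒∣p∣≤∣q∣ (drop-∷-⊆ A⊆X)) (<⇒≱ le)
∣X∣≤∣A∣⇒A⊆X⇒A≡X (inside ∷ A)  (outside ∷ X) le A⊆X with A⊆X Vec.here
... | ()
∣X∣≤∣A∣⇒A⊆X⇒A≡X (inside ∷ A)  (inside ∷ X)  le A⊆X = cong (inside ∷_) (∣X∣≤∣A∣⇒A⊆X⇒A≡X A X (s≤s⁻¹ le) (drop-∷-⊆ A⊆X))

-- `_⊂_` asks for a point of `X` outside `A`. It is found by deciding `A ⊂ X`: without such a point
-- `X ⊆ A`, against the sizes.
⊆∧∣∣<⇒⊂ : (A X : Subset n) → A ⊆ X → ∣ A ∣ < ∣ X ∣ → A ⊂ X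
⊆∧∣∣<⇒⊂ A X A⊆X lt with A ⊂? X
... | yes A⊂X = A⊂X
... | no A⊄X  = contradiction (p⊆q⇒∣p∣≤∣q∣ X⊆A) (<⇒≱ lt)
  where
  X⊆A : X ⊆ A
  X⊆A {x} x∈X with x ∈? A
  ... | yes x∈A = x∈A
  ... | no x∉A  = contradiction ((λ {y} → A⊆X {y}) , x , x∈X , x∉A) A⊄X

-- Lower covers and maximal chains of intervals.

lowerCovers : Subset n → List (Subset n)
lowerCovers []            = []
lowerCovers (outside ∷ X) = map (outside ∷_) (lowerCovers X)
lowerCovers (inside ∷ X)  = (outside ∷ X) ∷ map (inside ∷_) (lowerCovers X)

∈-lowerCovers⇒∣∣ : (X : Subset n) {Y : Subset n} → Y ∈ lowerCovers X → ∣ X ∣ ≡ suc ∣ Y ∣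
∈-lowerCovers⇒∣∣ (outside ∷ X) Y∈ with ∈-map⁻ (outside ∷_) Y∈
... | _ , Y′∈ , refl = ∈-lowerCovers⇒∣∣ X Y′∈
∈-lowerCovers⇒∣∣ (inside ∷ X) (here refl) = refl
∈-lowerCovers⇒∣∣ (inside ∷ X) (there Y∈) with ∈-map⁻ (inside ∷_) Y∈
... | _ , Y′∈ , refl = cong suc (∈-lowerCovers⇒∣∣ X Y′∈)

length-lowerCovers : (X : Subset n) → length (lowerCovers X) ≡ ∣ X ∣
length-lowerCovers []            = refl
length-lowerCovers (outside ∷ X) = trans (length-map _ (lowerCovers X)) (length-lowerCovers X)
length-lowerCovers (inside ∷ X)  = cong suc (trans (length-map _ (lowerCovers X)) (length-lowerCovers X))

-- For `A ⊆ X`, a lower cover still contains `A` exactly when the deleted element lies outside `A`.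
-- For `A ⊈ X` no lower cover contains `A`, and the factor `𝟙⊆ A X` is zero.
∑-lowerCovers-𝟙⊆ : (A X : Subset n) → ∑ (lowerCovers X) (𝟙⊆ A) ≡ 𝟙⊆ A X * (∣ X ∣ ∸ ∣ A ∣)
∑-lowerCovers-𝟙⊆ []            []            = refl
∑-lowerCovers-𝟙⊆ (outside ∷ A) (outside ∷ X) = trans (∑-map (lowerCovers X) (outside ∷_) _) (∑-lowerCovers-𝟙⊆ A X)
∑-lowerCovers-𝟙⊆ (outside ∷ A) (inside ∷ X)
  rewrite ∑-map (lowerCovers X) (inside ∷_) (𝟙⊆ (outside ∷ A)) | ∑-lowerCovers-𝟙⊆ A X with A ⊆? X
... | yes A⊆X = sym (trans (+-identityʳ _) (trans (+-∸-assoc 1 (p⊆q⇒∣p∣≤∣q∣ A⊆X)) (cong suc (sym (+-identityʳ _)))))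
... | no _    = refl
∑-lowerCovers-𝟙⊆ (inside ∷ A)  (outside ∷ X) = ∑-zero (map (outside ∷_) (lowerCovers X)) zero-term
  where
  zero-term : ∀ {Y} → Y ∈ map (outside ∷_) (lowerCovers X) → 𝟙⊆ (inside ∷ A) Y ≡ 0
  zero-term Y∈ with ∈-map⁻ (outside ∷_) Y∈
  ... | _ , _ , refl = refl
∑-lowerCovers-𝟙⊆ (inside ∷ A)  (inside ∷ X)  = trans (∑-map (lowerCovers X) (inside ∷_) _) (∑-lowerCovers-𝟙⊆ A X)

-- The number of maximal chains of the interval [A, X], and 0 if A ⊈ X.
paths : Subset n → Subset n → ℕ
paths A X = 𝟙⊆ A X * (∣ X ∣ ∸ ∣ A ∣) !

paths≢0⇒⊆ : (A X : Subset n) → paths A X ≢ 0 → A ⊆ X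
paths≢0⇒⊆ A X ≢0 = 𝟙≢0⇒ (A ⊆? X) (λ eq → ≢0 (cong (_* (∣ X ∣ ∸ ∣ A ∣) !) eq))

paths-⊈ : (A X : Subset n) → ¬ (A ⊆ X) → paths A X ≡ 0
paths-⊈ A X A⊈X rewrite 𝟙-no (A ⊆? X) A⊈X = refl

paths-⊆ : (A X : Subset n) → A ⊆ X → paths A X ≡ (∣ X ∣ ∸ ∣ A ∣) !
paths-⊆ A X A⊆X rewrite 𝟙-yes (A ⊆? X) A⊆X = +-identityʳ _

-- A chain from `A` to `X` is trivial or has a last step from a lower cover of `X`. This recursion
-- at the upper end drives the chain counts below.
paths-lowerCovers : (A X : Subset n) → paths A X ≡ 𝟙≡ A X + ∑ (lowerCovers X) (paths A)
paths-lowerCovers A X = trans (by-gap (∣ X ∣ ∸ ∣ A ∣) refl) (cong (𝟙≡ A X +_) (sym below))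
  where
  open ≤-Reasoning
  gap : ∀ {Y} → Y ∈ lowerCovers X → ∣ Y ∣ ∸ ∣ A ∣ ≡ pred (∣ X ∣ ∸ ∣ A ∣)
  gap {Y} Y∈ rewrite ∈-lowerCovers⇒∣∣ X Y∈ = sym (pred[m∸n]≡m∸[1+n] (suc ∣ Y ∣) ∣ A ∣)
  below : ∑ (lowerCovers X) (paths A) ≡ 𝟙⊆ A X * (∣ X ∣ ∸ ∣ A ∣) * (pred (∣ X ∣ ∸ ∣ A ∣)) !
  below = begin-equality
    ∑ (lowerCovers X) (paths A)
      ≡⟨ ∑-cong (lowerCovers X) (λ {Y} Y∈ → cong (λ d → 𝟙⊆ A Y * d !) (gap Y∈)) ⟩
    ∑ (lowerCovers X) (λ Y → 𝟙⊆ A Y * (pred (∣ X ∣ ∸ ∣ A ∣)) !)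
      ≡⟨ ∑-*ʳ (lowerCovers X) (𝟙⊆ A) _ ⟩
    ∑ (lowerCovers X) (𝟙⊆ A) * (pred (∣ X ∣ ∸ ∣ A ∣)) !
      ≡⟨ cong (_* (pred (∣ X ∣ ∸ ∣ A ∣)) !) (∑-lowerCovers-𝟙⊆ A X) ⟩
    𝟙⊆ A X * (∣ X ∣ ∸ ∣ A ∣) * (pred (∣ X ∣ ∸ ∣ A ∣)) !
      ∎
  -- `d ! = d * (pred d) !` fails only at `d = 0`; there `A ⊆ X` forces `A ≡ X`, which the term
  -- `𝟙≡ A X` accounts for.
  by-gap : ∀ d → ∣ X ∣ ∸ ∣ A ∣ ≡ d → 𝟙⊆ A X * d ! ≡ 𝟙≡ A X + 𝟙⊆ A X * d * (pred d) !
  by-gap zero eq = begin-equality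
    𝟙⊆ A X * 1                    ≡⟨ *-identityʳ _ ⟩
    𝟙⊆ A X                        ≡⟨ 𝟙-cong (A ⊆? X) (A ≟ˢ X) (∣X∣≤∣A∣⇒A⊆X⇒A≡X A X (m∸n≡0⇒m≤n eq)) (λ { refl → ⊆-refl }) ⟩
    𝟙≡ A X                        ≡⟨ +-identityʳ _ ⟨
    𝟙≡ A X + 0                    ≡⟨ cong (λ z → 𝟙≡ A X + z * 1) (*-zeroʳ (𝟙⊆ A X)) ⟨
    𝟙≡ A X + 𝟙⊆ A X * 0 * 1       ∎
  by-gap (suc d) eq = trans (sym (*-assoc (𝟙⊆ A X) (suc d) (d !)))
    (cong (_+ 𝟙⊆ A X * suc d * d !) (sym (𝟙-no (A ≟ˢ X) λ { refl → 0≢1+n (trans (sym (n∸n≡0 ∣ A ∣)) eq) })))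

-- Only one member of a level meets a given maximal chain of [A, Z].
level-paths≤paths : {F : List (Subset n)} → Unique F → (k : ℕ) (A Z : Subset n) →
  ∑ F (λ X → 𝟙 (∣ X ∣ ≟ k) * (paths A X * paths X Z)) ≤ paths A Z
level-paths≤paths {n} {F} u k A Z = go ∣ Z ∣ Z refl
  where
  open ≤-Reasoning
  w : Subset n → ℕ
  w X = 𝟙 (∣ X ∣ ≟ k) * paths A X
  split : ∀ Z X → 𝟙 (∣ X ∣ ≟ k) * (paths A X * paths X Z) ≡ 𝟙≡ X Z * w X + ∑ (lowerCovers Z) (λ Y → 𝟙 (∣ X ∣ ≟ k) * (paths A X * paths X Y))
  split Z X = begin-equality
    𝟙 (∣ X ∣ ≟ k) * (paths A X * paths X Z)
      ≡⟨ *-assoc (𝟙 (∣ X ∣ ≟ k)) (paths A X) _ ⟨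
    w X * paths X Z
      ≡⟨ cong (w X *_) (paths-lowerCovers X Z) ⟩
    w X * (𝟙≡ X Z + ∑ (lowerCovers Z) (paths X))
      ≡⟨ *-distribˡ-+ (w X) (𝟙≡ X Z) _ ⟩
    w X * 𝟙≡ X Z + w X * ∑ (lowerCovers Z) (paths X)
      ≡⟨ cong₂ _+_ (*-comm (w X) (𝟙≡ X Z)) (sym (∑-*ˡ (lowerCovers Z) (w X) (paths X))) ⟩
    𝟙≡ X Z * w X + ∑ (lowerCovers Z) (λ Y → w X * paths X Y)
      ≡⟨ cong (𝟙≡ X Z * w X +_) (∑-cong (lowerCovers Z) (λ _ → *-assoc (𝟙 (∣ X ∣ ≟ k)) (paths A X) _)) ⟩
    𝟙≡ X Z * w X + ∑ (lowerCovers Z) (λ Y → 𝟙 (∣ X ∣ ≟ k) * (paths A X * paths X Y))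
      ∎
  level : Subset n → ℕ
  level Z = ∑ F (λ X → 𝟙 (∣ X ∣ ≟ k) * (paths A X * paths X Z))
  -- `Z` itself occurs in `F` at most once, hence the bound `w Z`; chains through any other member
  -- enter `Z` from a lower cover.
  level-split : ∀ Z → level Z ≤ w Z + ∑ (lowerCovers Z) level
  level-split Z = begin
    level Z
      ≡⟨ ∑-cong F (λ {X} _ → split Z X) ⟩
    ∑ F (λ X → 𝟙≡ X Z * w X + ∑ (lowerCovers Z) (λ Y → 𝟙 (∣ X ∣ ≟ k) * (paths A X * paths X Y)))
      ≡⟨ ∑-+ F _ _ ⟩
    ∑ F (λ X → 𝟙≡ X Z * w X) + ∑ F (λ X → ∑ (lowerCovers Z) (λ Y → 𝟙 (∣ X ∣ ≟ k) * (paths A X * paths X Y)))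
      ≡⟨ cong₂ _+_ (∑-𝟙≡ F Z w) (∑-swap F (lowerCovers Z) _) ⟩
    ∑ F (λ X → 𝟙≡ X Z) * w Z + ∑ (lowerCovers Z) level
      ≤⟨ +-monoˡ-≤ _ (*-monoˡ-≤ (w Z) (∑-𝟙≡≤1 u Z)) ⟩
    1 * w Z + ∑ (lowerCovers Z) level
      ≡⟨ cong (_+ ∑ (lowerCovers Z) level) (*-identityˡ (w Z)) ⟩
    w Z + ∑ (lowerCovers Z) level
      ∎
  below-level : ∀ {Y} → ∣ Y ∣ < k → level Y ≡ 0
  below-level {Y} Y<k = ∑-zero F λ {X} _ → 𝟙*≡0 (∣ X ∣ ≟ k) λ { refl →
    trans (cong (paths A X *_) (paths-⊈ X Y λ X⊆Y → <⇒≱ Y<k (p⊆q⇒∣p∣≤∣q∣ X⊆Y))) (*-zeroʳ (paths A X)) }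
  -- At `∣ Z ∣ ≡ k` the lower covers lie below level `k` and contribute nothing, so only `w Z` is
  -- left. At any other size `w Z` is zero, and the bounds for the lower covers add up to at most
  -- `paths A Z`.
  go : ∀ s Z → ∣ Z ∣ ≡ s → level Z ≤ paths A Z
  go s Z eq with ∣ Z ∣ ≟ k
  ... | yes refl = begin
    level Z                              ≤⟨ level-split Z ⟩
    w Z + ∑ (lowerCovers Z) level
      ≡⟨ cong (w Z +_) (∑-zero (lowerCovers Z) λ {Y} Y∈ → below-level (≤-reflexive (sym (∈-lowerCovers⇒∣∣ Z Y∈)))) ⟩
    w Z + 0                              ≡⟨ +-identityʳ (w Z) ⟩
    w Z                                  ≤⟨ 𝟙*≤ (∣ Z ∣ ≟ k) (paths A Z) ⟩
    paths A Z                            ∎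
  ... | no ≢k = begin
    level Z                              ≤⟨ level-split Z ⟩
    w Z + ∑ (lowerCovers Z) level
      ≡⟨ cong (_+ ∑ (lowerCovers Z) level) (𝟙*≡0 (∣ Z ∣ ≟ k) λ eq → contradiction eq ≢k) ⟩
    ∑ (lowerCovers Z) level              ≤⟨ ∑-mono (lowerCovers Z) (descend s eq) ⟩
    ∑ (lowerCovers Z) (paths A)          ≤⟨ m≤n+m _ (𝟙≡ A Z) ⟩
    𝟙≡ A Z + ∑ (lowerCovers Z) (paths A) ≡⟨ paths-lowerCovers A Z ⟨
    paths A Z                            ∎
    where
    descend : ∀ s → ∣ Z ∣ ≡ s → ∀ {Y} → Y ∈ lowerCovers Z → level Y ≤ paths A Y
    descend zero    eq Y∈     = contradiction (trans (sym eq) (∈-lowerCovers⇒∣∣ Z Y∈)) 0≢1+n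
    descend (suc s) eq {Y} Y∈ = go s Y (suc-injective (trans (sym (∈-lowerCovers⇒∣∣ Z Y∈)) eq))

paths*paths≡0 : (A X Z : Subset n) → ¬ (A ⊆ X × X ⊆ Z) → paths A X * paths X Z ≡ 0
paths*paths≡0 A X Z ¬⊆ with A ⊆? X
... | no _    = refl
... | yes A⊆X = trans (cong (1 * (∣ X ∣ ∸ ∣ A ∣) ! *_) (paths-⊈ X Z λ X⊆Z → ¬⊆ (A⊆X , X⊆Z))) (*-zeroʳ (1 * (∣ X ∣ ∸ ∣ A ∣) !))

paths*paths≢0⇒⊆ : (A X Z : Subset n) → paths A X * paths X Z ≢ 0 → A ⊆ X × X ⊆ Z
paths*paths≢0⇒⊆ A X Z ≢0 =
  paths≢0⇒⊆ A X (λ eq → ≢0 (cong (_* paths X Z) eq)) ,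
  paths≢0⇒⊆ X Z (λ eq → ≢0 (trans (cong (paths A X *_) eq) (*-zeroʳ (paths A X))))

-- Members of the family inside one interval, level by level.

-- `L` only has to contain the sizes at which `f` is nonzero, so the levels of one interval suffice
-- for a sum over all of `F`.
∑≤∑-levels : (F : List (Subset n)) (f : Subset n → ℕ) (L : List ℕ) →
  (∀ {X} → X ∈ F → f X ≢ 0 → ∣ X ∣ ∈ L) → ∑ F f ≤ ∑ L (λ k → ∑ F (λ X → 𝟙 (∣ X ∣ ≟ k) * f X))
∑≤∑-levels F f L covered = ≤-trans (∑-mono F pointwise) (≤-reflexive (∑-swap F L _))
  where
  open ≤-Reasoning
  pointwise : ∀ {X} → X ∈ F → f X ≤ ∑ L (λ k → 𝟙 (∣ X ∣ ≟ k) * f X)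
  pointwise {X} X∈F with f X ≟ 0
  ... | yes eq = ≤-trans (≤-reflexive eq) z≤n
  ... | no ≢0  = begin
    f X                                ≡⟨ *-identityˡ (f X) ⟨
    1 * f X                            ≡⟨ cong (_* f X) (𝟙-yes (∣ X ∣ ≟ ∣ X ∣) refl) ⟨
    𝟙 (∣ X ∣ ≟ ∣ X ∣) * f X            ≤⟨ term≤∑ (λ k → 𝟙 (∣ X ∣ ≟ k) * f X) (covered X∈F ≢0) ⟩
    ∑ L (λ k → 𝟙 (∣ X ∣ ≟ k) * f X)    ∎

Between : Subset n → Subset n → ℕ → Subset n → Set
Between A Z k X = ∣ X ∣ ≡ k × A ⊆ X × X ⊆ Z

between? : (A Z : Subset n) (k : ℕ) → Decidable (Between A Z k)
between? A Z k X = (∣ X ∣ ≟ k) ×-dec ((A ⊆? X) ×-dec (X ⊆? Z))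

module _ {F : List (Subset n)} (F! : Unique F) (A Z : Subset n) (e : ℕ)
  (few : ∀ k → ∣ A ∣ < k → k < ∣ Z ∣ → length (filter (between? A Z k) F) ≤ 3 ^ e) where

  open ≤-Reasoning

  private
    a N : ℕ
    a = ∣ A ∣
    N = ∣ Z ∣ ∸ ∣ A ∣

    level : ℕ → ℕ
    level k = ∑ F (λ X → 𝟙 (∣ X ∣ ≟ k) * (paths A X * paths X Z))

    level≤ : ∀ k → level k ≤ paths A Z
    level≤ k = level-paths≤paths F! k A Z

    ∑≤∑-interval : ∑ F (λ X → paths A X * paths X Z) ≤ ∑ (applyUpTo (a +_) (suc N)) level
    ∑≤∑-interval = ∑≤∑-levels F _ _ λ {X} _ ≢0 →
      let A⊆X , X⊆Z = paths*paths≢0⇒⊆ A X Z ≢0 in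
      subst (_∈ applyUpTo (a +_) (suc N)) (m+[n∸m]≡n (p⊆q⇒∣p∣≤∣q∣ A⊆X))
        (∈-applyUpTo⁺ (a +_) (s≤s (∸-monoˡ-≤ a (p⊆q⇒∣p∣≤∣q∣ X⊆Z))))

    ∑-levels≤ : (g : ℕ → ℕ) (l : ℕ) → ∑ (applyUpTo g l) level ≤ l * paths A Z
    ∑-levels≤ g l = ≤-trans (∑-≤-const (applyUpTo g l) (paths A Z) (λ {k} _ → level≤ k))
      (≤-reflexive (cong (_* paths A Z) (length-applyUpTo g l)))

    -- At most `3 ^ e` members lie on the level, each on `(k ∸ a) ! * (∣ Z ∣ ∸ k) !` maximal chains
    -- of [A, Z]. Both gaps are at least `e + 1`, so by log-convexity this product is largest when
    -- one of them equals `e + 1` and the other `N - (e + 1) = e + M`.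
    middle : ∀ M → A ⊆ Z → N ≡ suc e + (e + M) → ∀ i → i < M →
      level (a + (suc e + i)) ≤ 3 ^ e * (suc e ! * (e + M) !)
    middle M A⊆Z N≡ i i<M = ≤-trans
      (∑≤length-filter (between? A Z k) F b inside-bound outside-zero)
      (*-monoˡ-≤ b (few k (m<m+n a (s≤s z≤n)) k<))
      where
      k q b : ℕ
      k = a + (suc e + i)
      -- The number of middle levels above the current one; the gap up to `Z` is then `suc e + q`.
      q = M ∸ suc i
      b = suc e ! * (e + M) !
      M≡ : M ≡ suc (i + q)
      M≡ = sym (m+[n∸m]≡n i<M)
      rearr : ∀ e i q → suc e + (e + suc (i + q)) ≡ suc e + i + (suc e + q)
      rearr = solve-∀
      N≡′ : N ≡ suc e + i + (suc e + q)
      N≡′ = trans N≡ (trans (cong (λ z → suc e + (e + z)) M≡) (rearr e i q))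
      Z≡ : ∣ Z ∣ ≡ a + N
      Z≡ = sym (m+[n∸m]≡n (p⊆q⇒∣p∣≤∣q∣ A⊆Z))
      k< : k < ∣ Z ∣
      k< = subst (k <_) (sym (trans Z≡ (cong (a +_) N≡′))) (+-monoʳ-< a (m<m+n (suc e + i) (s≤s z≤n)))
      gap : ∣ Z ∣ ∸ k ≡ suc e + q
      gap = trans (cong (_∸ k) (trans Z≡ (cong (a +_) N≡′)))
        (trans ([m+n]∸[m+o]≡n∸o a (suc e + i + (suc e + q)) (suc e + i)) (m+n∸m≡n (suc e + i) (suc e + q)))
      inside-bound : ∀ {X} → X ∈ F → Between A Z k X → 𝟙 (∣ X ∣ ≟ k) * (paths A X * paths X Z) ≤ b
      inside-bound {X} _ (X≡ , A⊆X , X⊆Z) = begin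
        𝟙 (∣ X ∣ ≟ k) * (paths A X * paths X Z)   ≤⟨ 𝟙*≤ (∣ X ∣ ≟ k) _ ⟩
        paths A X * paths X Z                     ≡⟨ cong₂ _*_ (paths-⊆ A X A⊆X) (paths-⊆ X Z X⊆Z) ⟩
        (∣ X ∣ ∸ a) ! * (∣ Z ∣ ∸ ∣ X ∣) !         ≡⟨ cong (λ x → (x ∸ a) ! * (∣ Z ∣ ∸ x) !) X≡ ⟩
        (k ∸ a) ! * (∣ Z ∣ ∸ k) !                 ≡⟨ cong₂ (λ x y → x ! * y !) (m+n∸m≡n a (suc e + i)) gap ⟩
        (suc e + i) ! * (suc e + q) !             ≤⟨ !-logConvex (suc e) i q ⟩
        suc e ! * (suc e + i + q) !               ≡⟨ cong (λ z → suc e ! * z !) (trans (shift e i q) (cong (e +_) (sym M≡))) ⟩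
        suc e ! * (e + M) !                       ∎
        where
        shift : ∀ e i q → suc e + i + q ≡ e + suc (i + q)
        shift = solve-∀
      outside-zero : ∀ {X} → X ∈ F → ¬ Between A Z k X → 𝟙 (∣ X ∣ ≟ k) * (paths A X * paths X Z) ≡ 0
      outside-zero {X} _ ¬btw = 𝟙*≡0 (∣ X ∣ ≟ k) λ X≡ → paths*paths≡0 A X Z λ ⊆s → ¬btw (X≡ , ⊆s)

    -- One factor `suc e` is split off `suc e !`. The rest is at most `N * (N - 1) ! = N !`, because
    -- `M ≤ N` and `3 ^ e` is at most the binomial coefficient `(N - 1) C e`, where
    -- `N - 1 = e + (e + M)`.
    middle-total : ∀ M → A ⊆ Z → N ≡ suc e + (e + M) → e ≤ M →
      M * (3 ^ e * (suc e ! * (e + M) !)) ≤ suc e * paths A Z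
    middle-total M A⊆Z N≡ e≤M = begin
      M * (3 ^ e * (suc e * e ! * (e + M) !))        ≡⟨ rearr M (3 ^ e) (suc e) (e !) ((e + M) !) ⟩
      suc e * (M * (3 ^ e * (e ! * (e + M) !)))      ≤⟨ *-monoʳ-≤ (suc e) (*-mono-≤ M≤ (3^e*e!*M!≤[e+M]! e (e + M) (+-monoʳ-≤ e e≤M))) ⟩
      suc e * (suc (e + (e + M)) * (e + (e + M)) !)  ≡⟨ cong (λ z → suc e * z !) N≡ ⟨
      suc e * N !                                    ≡⟨ cong (suc e *_) (paths-⊆ A Z A⊆Z) ⟨
      suc e * paths A Z                              ∎
      where
      rearr : ∀ M t s f g → M * (t * (s * f * g)) ≡ s * (M * (t * (f * g)))
      rearr = solve-∀
      M≤ : M ≤ suc (e + (e + M))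
      M≤ = ≤-trans (m≤n+m M e) (≤-trans (m≤n+m (e + M) e) (n≤1+n _))

    -- The levels are cut into the lowest `suc e`, the `M` middle ones and the highest `suc e`; each
    -- of the three blocks contributes at most `suc e * paths A Z`.
    long-interval : A ⊆ Z → 3 * suc e ≤ N → ∑ (applyUpTo (a +_) (suc N)) level ≤ 3 * suc e * paths A Z
    long-interval A⊆Z le = begin
      ∑ (applyUpTo (a +_) (suc N)) level
        ≡⟨ cong (λ L → ∑ L level) split ⟩
      ∑ (applyUpTo (a +_) (suc e) ++ (applyUpTo g M ++ applyUpTo (λ i → g (M + i)) (suc e))) level
        ≡⟨ ∑-++ (applyUpTo (a +_) (suc e)) _ level ⟩
      ∑ (applyUpTo (a +_) (suc e)) level + ∑ (applyUpTo g M ++ applyUpTo (λ i → g (M + i)) (suc e)) level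
        ≡⟨ cong (∑ (applyUpTo (a +_) (suc e)) level +_) (∑-++ (applyUpTo g M) _ level) ⟩
      ∑ (applyUpTo (a +_) (suc e)) level + (∑ (applyUpTo g M) level + ∑ (applyUpTo (λ i → g (M + i)) (suc e)) level)
        ≤⟨ +-mono-≤ (∑-levels≤ (a +_) (suc e)) (+-mono-≤ middle-sum (∑-levels≤ (λ i → g (M + i)) (suc e))) ⟩
      suc e * paths A Z + (suc e * paths A Z + suc e * paths A Z)
        ≡⟨ triple (suc e) (paths A Z) ⟨
      3 * suc e * paths A Z
        ∎
      where
      g : ℕ → ℕ
      g i = a + (suc e + i)
      M : ℕ
      -- There are `N + 1` levels, so removing two blocks of `e + 1` leaves `N - 2e - 1`.
      M = N ∸ (suc e + e)
      three : ∀ e → 3 * suc e ≡ suc e + e + (2 + e)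
      three = solve-∀
      triple : ∀ s p → 3 * s * p ≡ s * p + (s * p + s * p)
      triple = solve-∀
      le′ : suc e + e + (2 + e) ≤ N
      le′ = subst (_≤ N) (three e) le
      N≡ : N ≡ suc e + (e + M)
      N≡ = trans (sym (m+[n∸m]≡n (≤-trans (m≤m+n (suc e + e) (2 + e)) le′))) (+-assoc (suc e) e M)
      e≤M : e ≤ M
      e≤M = ≤-trans (m≤n+m e 2) (≤-trans (≤-reflexive (sym (m+n∸m≡n (suc e + e) (2 + e)))) (∸-monoˡ-≤ (suc e + e) le′))
      reorder : ∀ e M → suc (suc e + (e + M)) ≡ suc e + (M + suc e)
      reorder = solve-∀
      split : applyUpTo (a +_) (suc N) ≡ applyUpTo (a +_) (suc e) ++ (applyUpTo g M ++ applyUpTo (λ i → g (M + i)) (suc e))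
      split = trans (cong (applyUpTo (a +_)) (trans (cong suc N≡) (reorder e M)))
        (trans (applyUpTo-+ (a +_) (suc e) (M + suc e)) (cong (applyUpTo (a +_) (suc e) ++_) (applyUpTo-+ g M (suc e))))
      middle-sum : ∑ (applyUpTo g M) level ≤ suc e * paths A Z
      middle-sum = begin
        ∑ (applyUpTo g M) level
          ≤⟨ ∑-≤-const (applyUpTo g M) (3 ^ e * (suc e ! * (e + M) !)) middle-term ⟩
        length (applyUpTo g M) * (3 ^ e * (suc e ! * (e + M) !))
          ≡⟨ cong (_* (3 ^ e * (suc e ! * (e + M) !))) (length-applyUpTo g M) ⟩
        M * (3 ^ e * (suc e ! * (e + M) !))
          ≤⟨ middle-total M A⊆Z N≡ e≤M ⟩
        suc e * paths A Z
          ∎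
        where
        middle-term : ∀ {k} → k ∈ applyUpTo g M → level k ≤ 3 ^ e * (suc e ! * (e + M) !)
        middle-term k∈ with ∈-applyUpTo⁻ g k∈
        ... | i , i<M , refl = middle M A⊆Z N≡ i i<M

  ∑-interval≤ : ∑ F (λ X → paths A X * paths X Z) ≤ 3 * suc e * paths A Z
  ∑-interval≤ = case (A ⊆? Z) of λ where
    (no A⊈Z)  → ≤-trans (≤-reflexive (∑-zero F λ {X} _ →
      paths*paths≡0 A X Z λ { (A⊆X , X⊆Z) → A⊈Z (⊆-trans A⊆X X⊆Z) })) z≤n
    (yes A⊆Z) → ≤-trans ∑≤∑-interval (case (3 * suc e ≤? N) of λ where
      (yes long)  → long-interval A⊆Z long
      -- Here `N + 1 ≤ 3 * suc e`, and `N + 1` is the number of levels.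
      (no ¬long) → ≤-trans (∑-levels≤ (a +_) (suc N)) (*-monoˡ-≤ (paths A Z) (≰⇒> ¬long)))

-- The first and the last member of the family on a maximal chain.

module _ {n} (F : List (Subset n)) where

  -- For `Unique F` this is the indicator of `X ∈ F`, and `1 ∸ multiplicity X` that of its negation.
  -- As a sum over `F` it fits the interchange of sums directly.
  multiplicity : Subset n → ℕ
  multiplicity X = ∑ F (λ A → 𝟙≡ A X)

  -- avoiding ∣ X ∣ X counts the maximal chains of [⊥, X] without a member of F strictly below X.
  avoiding : ℕ → Subset n → ℕ
  avoiding zero    X = 1
  avoiding (suc s) X = ∑ (lowerCovers X) (λ Y → (1 ∸ multiplicity Y) * avoiding s Y)

  -- For `A ∈ F`, the maximal chains of [⊥, A] whose first member of `F` is `A`. The first argument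
  -- of `avoiding` is the number of steps of such a chain.
  firstHits : Subset n → ℕ
  firstHits A = avoiding ∣ A ∣ A

  -- Sorts the maximal chains of [⊥, X] by their first member of F.
  firstHits-partition : Unique F → (X : Subset n) →
    ∑ F (λ A → firstHits A * paths A X) + (1 ∸ multiplicity X) * firstHits X ≡ ∣ X ∣ !
  firstHits-partition F! X = go ∣ X ∣ X refl
    where
    open ≤-Reasoning
    -- `hit X` counts the maximal chains of [⊥, X] that meet `F`, and `miss X` those that do not,
    -- `X` included.
    hit : Subset n → ℕ
    hit X = ∑ F (λ A → firstHits A * paths A X)
    miss : Subset n → ℕ
    miss X = (1 ∸ multiplicity X) * firstHits X
    hit-lowerCovers : ∀ X → hit X ≡ multiplicity X * firstHits X + ∑ (lowerCovers X) hit
    hit-lowerCovers X = begin-equality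
      hit X
        ≡⟨ ∑-cong F (λ {A} _ → term A) ⟩
      ∑ F (λ A → 𝟙≡ A X * firstHits A + ∑ (lowerCovers X) (λ Y → firstHits A * paths A Y))
        ≡⟨ ∑-+ F _ _ ⟩
      ∑ F (λ A → 𝟙≡ A X * firstHits A) + ∑ F (λ A → ∑ (lowerCovers X) (λ Y → firstHits A * paths A Y))
        ≡⟨ cong₂ _+_ (∑-𝟙≡ F X firstHits) (∑-swap F (lowerCovers X) _) ⟩
      multiplicity X * firstHits X + ∑ (lowerCovers X) hit
        ∎
      where
      term : ∀ A → firstHits A * paths A X ≡ 𝟙≡ A X * firstHits A + ∑ (lowerCovers X) (λ Y → firstHits A * paths A Y)
      term A = begin-equality
        firstHits A * paths A X
          ≡⟨ cong (firstHits A *_) (paths-lowerCovers A X) ⟩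
        firstHits A * (𝟙≡ A X + ∑ (lowerCovers X) (paths A))
          ≡⟨ *-distribˡ-+ (firstHits A) (𝟙≡ A X) _ ⟩
        firstHits A * 𝟙≡ A X + firstHits A * ∑ (lowerCovers X) (paths A)
          ≡⟨ cong₂ _+_ (*-comm (firstHits A) (𝟙≡ A X)) (sym (∑-*ˡ (lowerCovers X) (firstHits A) (paths A))) ⟩
        𝟙≡ A X * firstHits A + ∑ (lowerCovers X) (λ Y → firstHits A * paths A Y)
          ∎
    all : ∀ X → hit X + miss X ≡ ∑ (lowerCovers X) hit + firstHits X
    all X = begin-equality
      hit X + miss X
        ≡⟨ cong (_+ miss X) (hit-lowerCovers X) ⟩
      μ * firstHits X + ∑ (lowerCovers X) hit + (1 ∸ μ) * firstHits X
        ≡⟨ rearr μ (1 ∸ μ) (firstHits X) _ ⟩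
      ∑ (lowerCovers X) hit + (μ + (1 ∸ μ)) * firstHits X
        -- The truncated difference is a true one because `μ ≤ 1`, which is where `Unique F` enters.
        ≡⟨ cong (λ z → ∑ (lowerCovers X) hit + z * firstHits X) (m+[n∸m]≡n (∑-𝟙≡≤1 F! X)) ⟩
      ∑ (lowerCovers X) hit + 1 * firstHits X
        ≡⟨ cong (∑ (lowerCovers X) hit +_) (*-identityˡ (firstHits X)) ⟩
      ∑ (lowerCovers X) hit + firstHits X
        ∎
      where
      μ : ℕ
      μ = multiplicity X
      rearr : ∀ a b f s → a * f + s + b * f ≡ s + (a + b) * f
      rearr = solve-∀
    -- By induction each of the `∣ X ∣` lower covers accounts for `(∣ X ∣ - 1) !` chains, whether
    -- they hit or miss.
    go : ∀ s X → ∣ X ∣ ≡ s → hit X + miss X ≡ ∣ X ∣ !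
    go zero X eq = begin-equality
      hit X + miss X                        ≡⟨ all X ⟩
      ∑ (lowerCovers X) hit + firstHits X   ≡⟨ cong₂ _+_ (∑-zero (lowerCovers X) λ Y∈ → contradiction (trans (sym eq) (∈-lowerCovers⇒∣∣ X Y∈)) 0≢1+n) (cong (λ s → avoiding s X) eq) ⟩
      1                                     ≡⟨ cong _! eq ⟨
      ∣ X ∣ !                               ∎
    go (suc s) X eq = begin-equality
      hit X + miss X                        ≡⟨ all X ⟩
      ∑ (lowerCovers X) hit + firstHits X   ≡⟨ cong (λ s → ∑ (lowerCovers X) hit + avoiding s X) eq ⟩
      ∑ (lowerCovers X) hit + ∑ (lowerCovers X) (λ Y → (1 ∸ multiplicity Y) * avoiding s Y)
        ≡⟨ ∑-+ (lowerCovers X) hit _ ⟨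
      ∑ (lowerCovers X) (λ Y → hit Y + (1 ∸ multiplicity Y) * avoiding s Y)
        ≡⟨ ∑-cong (lowerCovers X) below ⟩
      ∑ (lowerCovers X) (λ _ → s !)         ≡⟨ ∑-const (lowerCovers X) (s !) ⟩
      length (lowerCovers X) * s !          ≡⟨ cong (_* s !) (trans (length-lowerCovers X) eq) ⟩
      suc s !                               ≡⟨ cong _! eq ⟨
      ∣ X ∣ !                               ∎
      where
      below : ∀ {Y} → Y ∈ lowerCovers X → hit Y + (1 ∸ multiplicity Y) * avoiding s Y ≡ s !
      below {Y} Y∈ = begin-equality
        hit Y + (1 ∸ multiplicity Y) * avoiding s Y ≡⟨ cong (λ s → hit Y + (1 ∸ multiplicity Y) * avoiding s Y) Y≡ ⟨
        hit Y + miss Y                              ≡⟨ go s Y Y≡ ⟩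
        ∣ Y ∣ !                                     ≡⟨ cong _! Y≡ ⟩
        s !                                         ∎
        where
        Y≡ : ∣ Y ∣ ≡ s
        Y≡ = suc-injective (trans (sym (∈-lowerCovers⇒∣∣ X Y∈)) eq)

  ∑-firstHits≤ : Unique F → (X : Subset n) → ∑ F (λ A → firstHits A * paths A X) ≤ ∣ X ∣ !
  ∑-firstHits≤ F! X = ≤-trans (m≤m+n _ _) (≤-reflexive (firstHits-partition F! X))

  -- A chain that ends in a member of `F` cannot miss `F`, so the second summand of the partition
  -- vanishes.
  ∣∣!≤∑-firstHits : Unique F → {X : Subset n} → X ∈ F → ∣ X ∣ ! ≤ ∑ F (λ A → firstHits A * paths A X)
  ∣∣!≤∑-firstHits F! {X} X∈F = ≤-reflexive (trans (sym (firstHits-partition F! X))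
    (trans (cong (λ z → ∑ F (λ A → firstHits A * paths A X) + z * firstHits X) (m≤n⇒m∸n≡0 present)) (+-identityʳ _)))
    where
    present : 1 ≤ multiplicity X
    present = ≤-trans (≤-reflexive (sym (𝟙-yes (X ≟ˢ X) refl))) (term≤∑ (λ A → 𝟙≡ A X) X∈F)

∁-injective : Injective {A = Subset n} _≡_ _≡_ ∁
∁-injective eq = ⊆-antisym (∁p⊆∁q⇒p⊇q (⊆-reflexive (sym eq))) (∁p⊆∁q⇒p⊇q (⊆-reflexive eq))

paths-∁ : (A X : Subset n) → paths (∁ X) (∁ A) ≡ paths A X
paths-∁ {n} A X = cong₂ (λ x y → x * y !)
  (𝟙-cong (∁ X ⊆? ∁ A) (A ⊆? X) ∁p⊆∁q⇒p⊇q p⊆q⇒∁p⊇∁q)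
  (begin-equality
    ∣ ∁ A ∣ ∸ ∣ ∁ X ∣              ≡⟨ cong₂ _∸_ (∣∁p∣≡n∸∣p∣ A) (∣∁p∣≡n∸∣p∣ X) ⟩
    n ∸ ∣ A ∣ ∸ (n ∸ ∣ X ∣)        ≡⟨ ∸-+-assoc n ∣ A ∣ (n ∸ ∣ X ∣) ⟩
    n ∸ (∣ A ∣ + (n ∸ ∣ X ∣))      ≡⟨ cong (n ∸_) (+-comm ∣ A ∣ (n ∸ ∣ X ∣)) ⟩
    n ∸ (n ∸ ∣ X ∣ + ∣ A ∣)        ≡⟨ ∸-+-assoc n (n ∸ ∣ X ∣) ∣ A ∣ ⟨
    n ∸ (n ∸ ∣ X ∣) ∸ ∣ A ∣        ≡⟨ cong (_∸ ∣ A ∣) (m∸[m∸n]≡n (∣p∣≤n X)) ⟩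
    ∣ X ∣ ∸ ∣ A ∣                  ∎)
  where open ≤-Reasoning

module _ {n} (F : List (Subset n)) where

  -- Complementation reverses inclusion: the last member of `F` on a chain becomes the first member
  -- of `map ∁ F` on the reversed chain of complements. The results on first members thus carry
  -- over.
  lastHits : Subset n → ℕ
  lastHits Z = firstHits (map ∁ F) (∁ Z)

  private
    dual : ∀ X → ∑ (map ∁ F) (λ A → firstHits (map ∁ F) A * paths A (∁ X)) ≡ ∑ F (λ Z → lastHits Z * paths X Z)
    dual X = trans (∑-map F ∁ _) (∑-cong F (λ {Z} _ → cong (lastHits Z *_) (paths-∁ X Z)))

  ∑-lastHits≤ : Unique F → (X : Subset n) → ∑ F (λ Z → lastHits Z * paths X Z) ≤ ∣ ∁ X ∣ !
  ∑-lastHits≤ F! X = subst (_≤ ∣ ∁ X ∣ !) (dual X) (∑-firstHits≤ (map ∁ F) (map⁺ ∁-injective F!) (∁ X))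

  ∣∁∣!≤∑-lastHits : Unique F → {X : Subset n} → X ∈ F → ∣ ∁ X ∣ ! ≤ ∑ F (λ Z → lastHits Z * paths X Z)
  ∣∁∣!≤∑-lastHits F! {X} X∈F = subst (∣ ∁ X ∣ ! ≤_) (dual X)
    (∣∣!≤∑-firstHits (map ∁ F) (map⁺ ∁-injective F!) (∈-map⁺ ∁ X∈F))

-- Dividing by n ! gives a LYM inequality: c bounds the average number of members of F on a
-- maximal chain of [A, Z], hence also on the maximal chains of the cube whose first and last
-- members of F are A and Z.
∑-∣∣!*∣∁∣!≤ : {F : List (Subset n)} → Unique F → (c : ℕ) →
  (∀ {A Z} → A ∈ F → Z ∈ F → ∑ F (λ X → paths A X * paths X Z) ≤ c * paths A Z) →
  ∑ F (λ X → ∣ X ∣ ! * ∣ ∁ X ∣ !) ≤ c * n !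
∑-∣∣!*∣∁∣!≤ {n} {F} F! c local = begin
  ∑ F (λ X → ∣ X ∣ ! * ∣ ∁ X ∣ !)
    -- A maximal chain through `X` consists of a part below and a part above `X`. As `X ∈ F`, the
    -- lower part has a first member of `F` and the upper part a last one.
    ≤⟨ ∑-mono F (λ X∈F → *-mono-≤ (∣∣!≤∑-firstHits F F! X∈F) (∣∁∣!≤∑-lastHits F F! X∈F)) ⟩
  ∑ F (λ X → ∑ F (λ A → f A * paths A X) * ∑ F (λ Z → l Z * paths X Z))
    ≡⟨ ∑-cong F (λ {X} _ → expand X) ⟩
  ∑ F (λ X → ∑ F (λ A → ∑ F (λ Z → f A * l Z * (paths A X * paths X Z))))
    ≡⟨ ∑-swap F F _ ⟩
  ∑ F (λ A → ∑ F (λ X → ∑ F (λ Z → f A * l Z * (paths A X * paths X Z))))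
    ≡⟨ ∑-cong F (λ {A} _ → trans (∑-swap F F _) (∑-cong F λ {Z} _ → ∑-*ˡ F (f A * l Z) _)) ⟩
  ∑ F (λ A → ∑ F (λ Z → f A * l Z * ∑ F (λ X → paths A X * paths X Z)))
    ≤⟨ ∑-mono F (λ {A} A∈F → ∑-mono F λ {Z} Z∈F → *-monoʳ-≤ (f A * l Z) (local A∈F Z∈F)) ⟩
  ∑ F (λ A → ∑ F (λ Z → f A * l Z * (c * paths A Z)))
    ≡⟨ ∑-swap F F _ ⟩
  ∑ F (λ Z → ∑ F (λ A → f A * l Z * (c * paths A Z)))
    ≡⟨ ∑-cong F (λ {Z} _ → collect Z) ⟩
  ∑ F (λ Z → c * (l Z * ∑ F (λ A → f A * paths A Z)))
    ≡⟨ ∑-*ˡ F c _ ⟩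
  c * ∑ F (λ Z → l Z * ∑ F (λ A → f A * paths A Z))
    -- The chains are reassembled: those up to `Z`, sorted by their first member, number at most
    -- `∣ Z ∣ ! = paths ⊥ Z`; sorting by the last member `Z` then gives at most `n !`.
    ≤⟨ *-monoʳ-≤ c (∑-mono F λ {Z} _ → *-monoʳ-≤ (l Z) (≤-trans (∑-firstHits≤ F F! Z) (from-⊥ Z))) ⟩
  c * ∑ F (λ Z → l Z * paths ⊥ Z)
    ≤⟨ *-monoʳ-≤ c (∑-lastHits≤ F F! ⊥) ⟩
  c * ∣ ∁ (⊥ {n}) ∣ !
    ≡⟨ cong (λ k → c * k !) (trans (∣∁p∣≡n∸∣p∣ (⊥ {n})) (cong (n ∸_) (∣⊥∣≡0 n))) ⟩
  c * n !
    ∎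
  where
  open ≤-Reasoning
  f l : Subset n → ℕ
  f = firstHits F
  l = lastHits F
  expand : ∀ X → ∑ F (λ A → f A * paths A X) * ∑ F (λ Z → l Z * paths X Z) ≡
    ∑ F (λ A → ∑ F (λ Z → f A * l Z * (paths A X * paths X Z)))
  expand X = trans (sym (∑-*ʳ F _ _)) (∑-cong F λ {A} _ →
    trans (sym (∑-*ˡ F (f A * paths A X) _)) (∑-cong F λ {Z} _ → rearr (f A) (paths A X) (l Z) (paths X Z)))
    where
    rearr : ∀ a b c d → a * b * (c * d) ≡ a * c * (b * d)
    rearr = solve-∀
  collect : ∀ Z → ∑ F (λ A → f A * l Z * (c * paths A Z)) ≡ c * (l Z * ∑ F (λ A → f A * paths A Z))
  collect Z = trans (∑-cong F λ {A} _ → rearr (f A) (l Z) c (paths A Z))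
    (trans (∑-*ˡ F (c * l Z) _) (*-assoc c (l Z) _))
    where
    rearr : ∀ a b c d → a * b * (c * d) ≡ c * b * (a * d)
    rearr = solve-∀
  from-⊥ : ∀ Z → ∣ Z ∣ ! ≤ paths ⊥ Z
  from-⊥ Z = ≤-reflexive (sym (trans (paths-⊆ ⊥ Z ⊥⊆) (cong (λ k → (∣ Z ∣ ∸ k) !) (∣⊥∣≡0 n))))

-- The central binomial coefficient.

-- With `h = k + p` and `n ∸ h = k + q` one has `n ∸ k = k + p + q`, so this is log-convexity at
-- `k`.
k≤h⇒h!*[n∸h]!≤k!*[n∸k]! : ∀ {n h k} → h ≤ n ∸ h → k ≤ h → h ! * (n ∸ h) ! ≤ k ! * (n ∸ k) !
k≤h⇒h!*[n∸h]!≤k!*[n∸k]! {n} {h} {k} h≤n∸h k≤h with m≤n⇒∃[o]m+o≡n k≤h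
... | p , refl with m≤n⇒∃[o]m+o≡n (≤-trans k≤h h≤n∸h)
... | q , k+q≡ = begin
  (k + p) ! * (n ∸ (k + p)) !  ≡⟨ cong (λ z → (k + p) ! * z !) k+q≡ ⟨
  (k + p) ! * (k + q) !        ≤⟨ !-logConvex k p q ⟩
  k ! * (k + p + q) !          ≡⟨ cong (λ z → k ! * z !) total ⟩
  k ! * (n ∸ k) !              ∎
  where
  open ≤-Reasoning
  h≤n : k + p ≤ n
  h≤n = ≤-trans h≤n∸h (m∸n≤m n (k + p))
  rearr : ∀ k p q → k + p + (k + q) ≡ k + (k + p + q)
  rearr = solve-∀
  total : k + p + q ≡ n ∸ k
  total = sym (trans (cong (_∸ k) (trans (sym (m+[n∸m]≡n h≤n)) (trans (cong (k + p +_) (sym k+q≡)) (rearr k p q)))) (m+n∸m≡n k _))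

central-!-minimal : ∀ n k → k ≤ n → (n / 2) ! * (n ∸ n / 2) ! ≤ k ! * (n ∸ k) !
central-!-minimal n k k≤n = case (k ≤? h) of λ where
    (yes k≤h) → k≤h⇒h!*[n∸h]!≤k!*[n∸k]! {n} h≤n∸h k≤h
    (no k≰h)  → begin
      -- The product is symmetric under `k ↦ n ∸ k`, and `n ≤ 2 * h + 1` puts `n ∸ k` in the lower
      -- half when `h < k`.
      h ! * (n ∸ h) !              ≤⟨ k≤h⇒h!*[n∸h]!≤k!*[n∸k]! {n} h≤n∸h (m≤n+o⇒m∸n≤o n k (n≤k+h (≰⇒> k≰h))) ⟩
      (n ∸ k) ! * (n ∸ (n ∸ k)) !  ≡⟨ cong (λ z → (n ∸ k) ! * z !) (m∸[m∸n]≡n k≤n) ⟩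
      (n ∸ k) ! * k !              ≡⟨ *-comm ((n ∸ k) !) (k !) ⟩
      k ! * (n ∸ k) !              ∎
  where
  open ≤-Reasoning
  h : ℕ
  h = n / 2
  double : ∀ h → h + h ≡ h * 2
  double = solve-∀
  h≤n∸h : h ≤ n ∸ h
  h≤n∸h = m+n≤o⇒m≤o∸n h (≤-trans (≤-reflexive (double h)) (m/n*n≤m n 2))
  n≤k+h : h < k → n ≤ k + h
  n≤k+h h<k = begin
    n              ≡⟨ m≡m%n+[m/n]*n n 2 ⟩
    n % 2 + h * 2  ≤⟨ +-monoˡ-≤ (h * 2) (s≤s⁻¹ (m%n<n n 2)) ⟩
    1 + h * 2      ≡⟨ cong suc (double h) ⟨
    suc h + h      ≤⟨ +-monoˡ-≤ h h<k ⟩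
    k + h          ∎

nCk*k!*[n∸k]!≡n! : ∀ {n k} → k ≤ n → (n C k) * (k ! * (n ∸ k) !) ≡ n !
nCk*k!*[n∸k]!≡n! {n} {k} k≤n =
  trans (cong (_* (k ! * (n ∸ k) !)) (nCk≡n!/k![n-k]! k≤n)) (m/n*n≡m (k![n∸k]!∣n! k≤n))
  where instance _ = k !* (n ∸ k) !≢0

n!≤nC[n/2]*∣X∣!*∣∁X∣! : (X : Subset n) → n ! ≤ (n C (n / 2)) * (∣ X ∣ ! * ∣ ∁ X ∣ !)
n!≤nC[n/2]*∣X∣!*∣∁X∣! {n} X = begin
  n !                                            ≡⟨ nCk*k!*[n∸k]!≡n! (m/n≤m n 2) ⟨
  (n C (n / 2)) * ((n / 2) ! * (n ∸ n / 2) !)    ≤⟨ *-monoʳ-≤ (n C (n / 2)) (central-!-minimal n ∣ X ∣ (∣p∣≤n X)) ⟩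
  (n C (n / 2)) * (∣ X ∣ ! * (n ∸ ∣ X ∣) !)      ≡⟨ cong (λ k → (n C (n / 2)) * (∣ X ∣ ! * k !)) (∣∁p∣≡n∸∣p∣ X) ⟨
  (n C (n / 2)) * (∣ X ∣ ! * ∣ ∁ X ∣ !)          ∎
  where open ≤-Reasoning

-- Every member lies on at least `n ! / (n C (n / 2))` maximal chains of the cube, while `c * n !`
-- bounds the total number of incidences.
length≤c*nC[n/2] : {F : List (Subset n)} → Unique F → (c : ℕ) →
  (∀ {A Z} → A ∈ F → Z ∈ F → ∑ F (λ X → paths A X * paths X Z) ≤ c * paths A Z) →
  length F ≤ c * (n C (n / 2))
length≤c*nC[n/2] {n} {F} F! c local = *-cancelʳ-≤ (length F) (c * b) (n !) {{n !≢0}} (begin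
  length F * n !                               ≡⟨ ∑-const F (n !) ⟨
  ∑ F (λ _ → n !)                              ≤⟨ ∑-mono F (λ {X} _ → n!≤nC[n/2]*∣X∣!*∣∁X∣! X) ⟩
  ∑ F (λ X → b * (∣ X ∣ ! * ∣ ∁ X ∣ !))        ≡⟨ ∑-*ˡ F b _ ⟩
  b * ∑ F (λ X → ∣ X ∣ ! * ∣ ∁ X ∣ !)          ≤⟨ *-monoʳ-≤ b (∑-∣∣!*∣∁∣!≤ F! c local) ⟩
  b * (c * n !)                                ≡⟨ rearr b c (n !) ⟩
  c * b * n !                                  ∎)
  where
  open ≤-Reasoning
  b : ℕ
  b = n C (n / 2)
  rearr : ∀ b c f → b * (c * f) ≡ c * b * f
  rearr = solve-∀

-- The forbidden configuration as a bound on interior levels.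

theorem2p22 : (m n : ℕ) → 2 ≤ m → (F : List (Subset n)) → Unique F →
    ((A C : Subset n) → (B : Fin m → Subset n) →
    A ∈ F → C ∈ F → (∀ i → B i ∈ F) →
    Injective _≡_ _≡_ B → A ≢ C → (∀ i → A ≢ B i) → (∀ i → B i ≢ C) →
    (∀ i → A ⊂ B i × B i ⊂ C) →
    ¬ (∀ i j → ∣ B i ∣ ≡ ∣ B j ∣)) →
    length F ≤ 3 * (ceilLog3 (m ∸ 1) + 1) * (n C (n / 2))
theorem2p22 m n 2≤m F F! noConfig = subst (λ s → length F ≤ 3 * s * (n C (n / 2))) (+-comm 1 e)
  (length≤c*nC[n/2] F! (3 * suc e) λ {A} {Z} A∈F Z∈F →
    ∑-interval≤ F! A Z e λ k A<k k<Z → ≤-trans (few A∈F Z∈F k A<k k<Z) (≤3^ceilLog3 (m ∸ 1)))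
  where
  e : ℕ
  e = ceilLog3 (m ∸ 1)
  few : ∀ {A Z} → A ∈ F → Z ∈ F → ∀ k → ∣ A ∣ < k → k < ∣ Z ∣ → length (filter (between? A Z k) F) ≤ m ∸ 1
  few {A} {Z} A∈F Z∈F k A<k k<Z = case (m ≤? length G) of λ where
      (no m≰)  → <⇒≤pred (≰⇒> m≰)
      -- The first `m` entries of `G` serve as the sets `B i`; they are distinct because `filter`
      -- preserves `Unique`. All have size `k`, strictly between `∣ A ∣` and `∣ Z ∣`, which yields
      -- the remaining inequalities and the strict inclusions.
      (yes m≤) → contradiction (λ i j → trans (B-size m≤ i) (sym (B-size m≤ j)))
        (noConfig A Z (B m≤) A∈F Z∈F (λ i → proj₁ (B-mem m≤ i))
          (λ eq → inject≤-injective m≤ m≤ _ _ (lookup-injective (filter⁺ (between? A Z k) F!) eq))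
          (λ { refl → <-asym A<k k<Z })
          (λ i eq → <⇒≢ (A<B m≤ i) (cong ∣_∣ eq))
          (λ i eq → <⇒≢ (B<Z m≤ i) (cong ∣_∣ eq))
          (λ i → let _ , _ , A⊆B , B⊆Z = B-mem m≤ i in
            ⊆∧∣∣<⇒⊂ A (B m≤ i) A⊆B (A<B m≤ i) , ⊆∧∣∣<⇒⊂ (B m≤ i) Z B⊆Z (B<Z m≤ i)))
    where
    G : List (Subset n)
    G = filter (between? A Z k) F
    module _ (m≤ : m ≤ length G) where
      B : Fin m → Subset n
      B i = lookup G (inject≤ i m≤)
      B-mem : ∀ i → B i ∈ F × Between A Z k (B i)
      B-mem i = ∈-filter⁻ (between? A Z k) (∈-lookup (inject≤ i m≤))
      B-size : ∀ i → ∣ B i ∣ ≡ k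
      B-size i = proj₁ (proj₂ (B-mem i))
      A<B : ∀ i → ∣ A ∣ < ∣ B i ∣
      A<B i = subst (∣ A ∣ <_) (sym (B-size i)) A<k
      B<Z : ∀ i → ∣ B i ∣ < ∣ Z ∣
      B<Z i = subst (_< ∣ Z ∣) (sym (B-size i)) k<Z
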